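{- Let $G$ be a $k$-uniform linear oriented hypergraph with incidence dual $G^*$ and intersection graph $\Lambda(G)$. If $\lambda$ is an eigenvalue of $A(\Lambda(G))$ (or of $A(G^*)$), then $\lambda\le k$.
   Context: A hypergraph $H=(V,E,\mathcal I)$ consists of a finite set $V$ of vertices, a finite family $E=(e_\iota)_{\iota\in\Omega}$ of subsets of $V$ (the edges; an edge may be empty, and edges with different indices are regarded as different even if they coincide as sets) and its incidences $\mathcal I$. All hypergraphs are simple: each vertex $v\in e$ is incident with $e$ exactly once, so $\mathcal I=\{(v,e): v\in e\}$. $H$ is linear if $|e\cap f|\le 1$ for any two edges $e,f$ with distinct indices; it is $k$-uniform if every edge has exactly $k$ elements. An oriented hypergraph is a pair $G=(H,\sigma)$ with $\sigma:\mathcal I\to\{+1,-1\}$; hypergraph terminology for $G$ refers to $H$. For an oriented hypergraph with vertices $v_1,\dots,v_n$, an edge $e$ and distinct $v_i,v_j\in e$, put $\mathrm{sgn}_e(v_i,v_j)=-\sigma(v_i,e)\sigma(v_j,e)$. The adjacency matrix $A=(a_{ij})\in\mathbb R^{n\times n}$ has $a_{ij}=\sum_{e}\mathrm{sgn}_e(v_i,v_j)$ for $i\ne j$, the sum being over all edges $e$ containing both $v_i$ and $v_j$ (so $a_{ij}=0$ if there are none), and $a_{ii}=0$. It is symmetric, so its eigenvalues are real. The incidence dual $G^*$ has vertex set $E$ and edge family $V$, where $e$ is incident with $v$ in $G^*$ iff $v$ is incident with $e$ in $G$; its orientation is $\sigma^*(e,v)=\sigma(v,e)$. Intersection graph: for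 a linear $G$, $\Lambda(G)$ is the oriented hypergraph with vertex set $E(G)$ and one edge $ef=\{e,f\}$ for each pair of distinct $e,f\in E(G)$ with $e\cap f\ne\varnothing$; if $v\in e\cap f$ then $\sigma_{\Lambda(G)}(e,ef)=\sigma_G(v,e)$ and $\sigma_{\Lambda(G)}(f,ef)=\sigma_G(v,f)$. -}

module Defs where

open import Algebra.Bundles using (CommutativeRing)
import Algebra.Properties.CommutativeMonoid.Sum as Sum
open import Data.Fin using (Fin)
import Data.Fin as Fin
import Data.Fin.Properties as Fin
open import Data.Fin.Subset using (Subset; _∈_; _∩_; _∪_; ⁅_⁆; ∣_∣; Nonempty)
open import Data.Fin.Subset.Properties
  using (_∈?_; nonempty?; x∈p∩q⁻; x∈p∪q⁻; x∈⁅y⁆⇒x≡y; p⊂q⇒∣p∣<∣q∣;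
         ∣⁅x⁆∣≡1)
open import Data.Integer using (+_)
open import Data.List using (List; length; filter; cartesianProduct; allFin)
import Data.List as List
open import Data.List.Membership.Propositional.Properties using (∈-lookup)
import Data.List.Relation.Unary.All as All
open import Data.List.Relation.Unary.All.Properties using (all-filter)
open import Data.Nat using (ℕ; _⊔_)
import Data.Nat as ℕ
import Data.Nat.Properties as ℕ
open import Data.Product using (∃; _×_; _,_; proj₁; proj₂)
open import Data.Rational as ℚ using (ℚ; 0ℚ; 1ℚ; ½; _+_; _*_; -_; _-_; _<_; _≤_)
  renaming (∣_∣ to abs)
import Data.Rational.Properties as ℚ
open import Data.Rational.Solver using (module +-*-Solver)
open import Data.Sign using (Sign)
import Data.Sign as Sign
open import Data.Sum using (inj₁; inj₂)
open import Data.Vec using (tabulate; lookup)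
open import Data.Vec.Functional using (Vector)
open import Data.Vec.Properties using (lookup∘tabulate; lookup⇒[]=; []=⇒lookup)
open import Level using (0ℓ)
open import Relation.Binary.PropositionalEquality
  using (_≡_; _≢_; refl; sym; trans; cong; subst)
open import Relation.Binary.Structures using (IsEquivalence)
open import Relation.Nullary using (¬_; yes; no; contradiction)
open import Relation.Nullary.Decidable using (_×-dec_)
open import Relation.Unary using (Decidable)

-- Real numbers: Cauchy sequences of rationals (not necessarily regular),
-- with equality and order taken up to arbitrarily small rational ε.

infix 4 _≃_ _≤ᴿ_
infixl 6 _+ᴿ_
infixl 7 _*ᴿ_
infix 8 -ᴿ_

record ℝ : Set where
  constructor mkℝ
  field
    seq    : ℕ → ℚ
    cauchy : ∀ ε → 0ℚ < ε →
             ∃ λ N → ∀ m n → N ℕ.≤ m → N ℕ.≤ n → abs (seq m - seq n) < ε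

open ℝ public

_≃_ : ℝ → ℝ → Set
x ≃ y = ∀ ε → 0ℚ < ε → ∃ λ N → ∀ n → N ℕ.≤ n → abs (seq x n - seq y n) < ε

_≤ᴿ_ : ℝ → ℝ → Set
x ≤ᴿ y = ∀ ε → 0ℚ < ε → ∃ λ N → ∀ n → N ℕ.≤ n → seq x n ≤ seq y n + ε

private
  half-sum : ∀ ε → ½ * ε + ½ * ε ≡ ε
  half-sum ε = trans (sym (ℚ.*-distribʳ-+ ε ½ ½)) (ℚ.*-identityˡ ε)

  0<½* : ∀ {ε} → 0ℚ < ε → 0ℚ < ½ * ε
  0<½* {ε} 0<ε = subst (_< ½ * ε) (ℚ.*-zeroʳ ½) (ℚ.*-monoʳ-<-pos ½ 0<ε)

  abs-sum : ∀ {p q ε δ} → abs p < ε → abs q < δ → abs (p + q) < ε + δ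
  abs-sum {p} {q} p< q< = ℚ.≤-<-trans (ℚ.∣p+q∣≤∣p∣+∣q∣ p q) (ℚ.+-mono-< p< q<)

  halves : ∀ {p q r} ε → r ≡ p + q → abs p < ½ * ε → abs q < ½ * ε → abs r < ε
  halves {p} {q} ε refl p< q< =
    subst (abs (p + q) <_) (half-sum ε) (abs-sum {p} {q} p< q<)

  abs-swap : ∀ p q → abs (p - q) ≡ abs (q - p)
  abs-swap p q = trans (cong abs (swap p q)) (ℚ.∣-p∣≡∣p∣ (q - p))
    where
    open +-*-Solver
    swap : ∀ p q → p - q ≡ - (q - p)
    swap = solve 2 (λ p q → p :- q := :- (q :- p)) refl

  diff-+ : ∀ a b c d → (a + b) - (c + d) ≡ (a - c) + (b - d)
  diff-+ = solve 4 (λ a b c d → (a :+ b) :- (c :+ d) := (a :- c) :+ (b :- d)) refl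
    where open +-*-Solver

  diff-neg : ∀ a b → (- a) - (- b) ≡ b - a
  diff-neg = solve 2 (λ a b → (:- a) :- (:- b) := b :- a) refl
    where open +-*-Solver

  diff-trans : ∀ a b c → a - c ≡ (a - b) + (b - c)
  diff-trans = solve 3 (λ a b c → a :- c := (a :- b) :+ (b :- c)) refl
    where open +-*-Solver

  diff-* : ∀ a b c d → a * b - c * d ≡ a * (b - d) + d * (a - c)
  diff-* = solve 4 (λ a b c d →
    a :* b :- c :* d := a :* (b :- d) :+ d :* (a :- c)) refl
    where open +-*-Solver

  abs-* : ∀ {p q B δ} → 0ℚ < B → abs p < B → abs q < δ → abs (p * q) < B * δ
  abs-* {p} {q} {B} {δ} 0<B p< q< =
    subst (_< B * δ) (sym (ℚ.∣p*q∣≡∣p∣*∣q∣ p q))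
      (ℚ.≤-<-trans
        (ℚ.*-monoʳ-≤-nonNeg (abs q) {{ℚ.nonNegative (ℚ.0≤∣p∣ q)}} (ℚ.<⇒≤ p<))
        (ℚ.*-monoʳ-<-pos B {{ℚ.positive 0<B}} q<))

  -- A single tolerance that controls the difference of two products.
  product-tolerance : ∀ A D ε → 0ℚ < A → 0ℚ < D → 0ℚ < ε →
    ∃ λ δ → 0ℚ < δ × (∀ a b c d → abs a < A → abs d < D →
      abs (b - d) < δ → abs (a - c) < δ → abs (a * b - c * d) < ε)
  product-tolerance A D ε 0<A 0<D 0<ε = δ , 0<δ , bound
    where
    S = A + D
    0<S : 0ℚ < S
    0<S = ℚ.+-mono-< 0<A 0<D
    instance
      pos-S : ℚ.Positive S
      pos-S = ℚ.positive 0<S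
      nonZero-S : ℚ.NonZero S
      nonZero-S = ℚ.pos⇒nonZero S
      pos-ε : ℚ.Positive ε
      pos-ε = ℚ.positive 0<ε
      pos-1/S : ℚ.Positive (ℚ.1/ S)
      pos-1/S = ℚ.1/pos⇒pos S
    δ = ℚ.1/ S * ε
    0<δ : 0ℚ < δ
    0<δ = ℚ.positive⁻¹ δ {{ℚ.pos*pos⇒pos (ℚ.1/ S) ε}}
    total : A * δ + D * δ ≡ ε
    total = trans (sym (ℚ.*-distribʳ-+ δ A D))
      (trans (sym (ℚ.*-assoc S (ℚ.1/ S) ε))
        (trans (cong (_* ε) (ℚ.*-inverseʳ S)) (ℚ.*-identityˡ ε)))
    bound : ∀ a b c d → abs a < A → abs d < D →
      abs (b - d) < δ → abs (a - c) < δ → abs (a * b - c * d) < ε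
    bound a b c d a< d< bd< ac< =
      subst (λ t → abs t < ε) (sym (diff-* a b c d))
        (subst (abs (a * (b - d) + d * (a - c)) <_) total
          (abs-sum {a * (b - d)} {d * (a - c)}
            (abs-* {a} {b - d} 0<A a< bd<) (abs-* {d} {a - c} 0<D d< ac<)))

  bounded : ∀ x → ∃ λ B → 0ℚ < B × ∃ λ N → ∀ n → N ℕ.≤ n → abs (seq x n) < B
  bounded x with cauchy x 1ℚ (ℚ.positive⁻¹ 1ℚ)
  ... | N , close = 1ℚ + b , 0<B , N , bound
    where
    b = abs (seq x N)
    0<B : 0ℚ < 1ℚ + b
    0<B = ℚ.+-mono-<-≤ (ℚ.positive⁻¹ 1ℚ) (ℚ.0≤∣p∣ (seq x N))
    split : ∀ p q → p ≡ (p - q) + q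
    split = solve 2 (λ p q → p := (p :- q) :+ q) refl
      where open +-*-Solver
    bound : ∀ n → N ℕ.≤ n → abs (seq x n) < 1ℚ + b
    bound n N≤n = subst (λ t → abs t < 1ℚ + b) (sym (split (seq x n) (seq x N)))
      (ℚ.≤-<-trans (ℚ.∣p+q∣≤∣p∣+∣q∣ (seq x n - seq x N) (seq x N))
        (ℚ.+-mono-<-≤ (close n N N≤n ℕ.≤-refl) ℚ.≤-refl))

  ⊔ˡ : ∀ {m n o} → m ⊔ n ℕ.≤ o → m ℕ.≤ o
  ⊔ˡ {m} {n} = ℕ.m⊔n≤o⇒m≤o m n

  ⊔ʳ : ∀ {m n o} → m ⊔ n ℕ.≤ o → n ℕ.≤ o
  ⊔ʳ {m} {n} = ℕ.m⊔n≤o⇒n≤o m n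

const : ℚ → ℝ
const q = mkℝ (λ _ → q) λ ε 0<ε → 0 , λ _ _ _ _ →
  subst (λ t → abs t < ε) (sym (ℚ.+-inverseʳ q)) 0<ε

0ℝ 1ℝ : ℝ
0ℝ = const 0ℚ
1ℝ = const 1ℚ

fromℕ : ℕ → ℝ
fromℕ k = const (+ k ℚ./ 1)

_+ᴿ_ : ℝ → ℝ → ℝ
x +ᴿ y = mkℝ (λ n → seq x n + seq y n) λ ε 0<ε →
  let M , close-x = cauchy x (½ * ε) (0<½* 0<ε)
      N , close-y = cauchy y (½ * ε) (0<½* 0<ε)
  in M ⊔ N , λ m n ≤m ≤n →
     halves ε (diff-+ (seq x m) (seq y m) (seq x n) (seq y n))
       (close-x m n (⊔ˡ ≤m) (⊔ˡ ≤n)) (close-y m n (⊔ʳ {M} ≤m) (⊔ʳ {M} ≤n))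

-ᴿ_ : ℝ → ℝ
-ᴿ x = mkℝ (λ n → - seq x n) λ ε 0<ε →
  let N , close = cauchy x ε 0<ε
  in N , λ m n ≤m ≤n →
     subst (λ t → abs t < ε) (sym (diff-neg (seq x m) (seq x n)))
       (close n m ≤n ≤m)

_*ᴿ_ : ℝ → ℝ → ℝ
x *ᴿ y = mkℝ (λ n → seq x n * seq y n) λ ε 0<ε →
  let A , 0<A , M₁ , bound-x = bounded x
      D , 0<D , M₂ , bound-y = bounded y
      δ , 0<δ , bound = product-tolerance A D ε 0<A 0<D 0<ε
      M₃ , close-x = cauchy x δ 0<δ
      M₄ , close-y = cauchy y δ 0<δ
  in (M₁ ⊔ M₂) ⊔ (M₃ ⊔ M₄) , λ m n ≤m ≤n →
     bound (seq x m) (seq y m) (seq x n) (seq y n)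
       (bound-x m (⊔ˡ {M₁} (⊔ˡ ≤m)))
       (bound-y n (⊔ʳ {M₁} (⊔ˡ ≤n)))
       (close-y m n (⊔ʳ {M₃} (⊔ʳ {M₁ ⊔ M₂} ≤m)) (⊔ʳ {M₃} (⊔ʳ {M₁ ⊔ M₂} ≤n)))
       (close-x m n (⊔ˡ {M₃} (⊔ʳ {M₁ ⊔ M₂} ≤m)) (⊔ˡ {M₃} (⊔ʳ {M₁ ⊔ M₂} ≤n)))

pointwise⇒≃ : ∀ x y → (∀ n → seq x n ≡ seq y n) → x ≃ y
pointwise⇒≃ x y eq ε 0<ε = 0 , λ n _ →
  subst (λ t → abs t < ε)
    (sym (trans (cong (_- seq y n) (eq n)) (ℚ.+-inverseʳ (seq y n)))) 0<ε

≃-isEquivalence : IsEquivalence _≃_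
≃-isEquivalence = record
  { refl  = λ {x} → pointwise⇒≃ x x (λ _ → refl)
  ; sym   = λ {x} {y} x≃y ε 0<ε →
      let N , close = x≃y ε 0<ε
      in N , λ n ≤n → subst (_< ε) (abs-swap (seq x n) (seq y n)) (close n ≤n)
  ; trans = λ {x} {y} {z} x≃y y≃z ε 0<ε →
      let M , close₁ = x≃y (½ * ε) (0<½* 0<ε)
          N , close₂ = y≃z (½ * ε) (0<½* 0<ε)
      in M ⊔ N , λ n ≤n →
         halves ε (diff-trans (seq x n) (seq y n) (seq z n))
           (close₁ n (⊔ˡ ≤n)) (close₂ n (⊔ʳ {M} ≤n))
  }

+ᴿ-cong : ∀ {x x′ y y′} → x ≃ x′ → y ≃ y′ → x +ᴿ y ≃ x′ +ᴿ y′
+ᴿ-cong {x} {x′} {y} {y′} x≃ y≃ ε 0<ε =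
  let M , close-x = x≃ (½ * ε) (0<½* 0<ε)
      N , close-y = y≃ (½ * ε) (0<½* 0<ε)
  in M ⊔ N , λ n ≤n →
     halves ε (diff-+ (seq x n) (seq y n) (seq x′ n) (seq y′ n))
       (close-x n (⊔ˡ ≤n)) (close-y n (⊔ʳ {M} ≤n))

-ᴿ-cong : ∀ {x x′} → x ≃ x′ → -ᴿ x ≃ -ᴿ x′
-ᴿ-cong {x} {x′} x≃ ε 0<ε =
  let N , close = x≃ ε 0<ε
  in N , λ n ≤n →
     subst (_< ε)
       (trans (abs-swap (seq x n) (seq x′ n))
         (cong abs (sym (diff-neg (seq x n) (seq x′ n)))))
       (close n ≤n)

*ᴿ-cong : ∀ {x x′ y y′} → x ≃ x′ → y ≃ y′ → x *ᴿ y ≃ x′ *ᴿ y′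
*ᴿ-cong {x} {x′} {y} {y′} x≃ y≃ ε 0<ε =
  let A , 0<A , M₁ , bound-x = bounded x
      D , 0<D , M₂ , bound-y = bounded y′
      δ , 0<δ , bound = product-tolerance A D ε 0<A 0<D 0<ε
      M₃ , close-x = x≃ δ 0<δ
      M₄ , close-y = y≃ δ 0<δ
  in (M₁ ⊔ M₂) ⊔ (M₃ ⊔ M₄) , λ n ≤n →
     bound (seq x n) (seq y n) (seq x′ n) (seq y′ n)
       (bound-x n (⊔ˡ {M₁} (⊔ˡ ≤n)))
       (bound-y n (⊔ʳ {M₁} (⊔ˡ ≤n)))
       (close-y n (⊔ʳ {M₃} (⊔ʳ {M₁ ⊔ M₂} ≤n)))
       (close-x n (⊔ˡ {M₃} (⊔ʳ {M₁ ⊔ M₂} ≤n)))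

ℝ-commutativeRing : CommutativeRing 0ℓ 0ℓ
ℝ-commutativeRing = record
  { Carrier = ℝ
  ; _≈_ = _≃_
  ; _+_ = _+ᴿ_
  ; _*_ = _*ᴿ_
  ; -_  = -ᴿ_
  ; 0#  = 0ℝ
  ; 1#  = 1ℝ
  ; isCommutativeRing = record
    { isRing = record
      { +-isAbelianGroup = record
        { isGroup = record
          { isMonoid = record
            { isSemigroup = record
              { isMagma = record
                { isEquivalence = ≃-isEquivalence
                ; ∙-cong = λ {x} {x′} {y} {y′} → +ᴿ-cong {x} {x′} {y} {y′}
                }
              ; assoc = λ x y z → pointwise⇒≃ ((x +ᴿ y) +ᴿ z) (x +ᴿ (y +ᴿ z))
                  λ n → ℚ.+-assoc (seq x n) (seq y n) (seq z n)
              }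
            ; identity =
                (λ x → pointwise⇒≃ (0ℝ +ᴿ x) x λ n → ℚ.+-identityˡ (seq x n))
              , (λ x → pointwise⇒≃ (x +ᴿ 0ℝ) x λ n → ℚ.+-identityʳ (seq x n))
            }
          ; inverse =
              (λ x → pointwise⇒≃ (-ᴿ x +ᴿ x) 0ℝ λ n → ℚ.+-inverseˡ (seq x n))
            , (λ x → pointwise⇒≃ (x +ᴿ -ᴿ x) 0ℝ λ n → ℚ.+-inverseʳ (seq x n))
          ; ⁻¹-cong = λ {x} {x′} → -ᴿ-cong {x} {x′}
          }
        ; comm = λ x y → pointwise⇒≃ (x +ᴿ y) (y +ᴿ x)
            λ n → ℚ.+-comm (seq x n) (seq y n)
        }
      ; *-cong = λ {x} {x′} {y} {y′} → *ᴿ-cong {x} {x′} {y} {y′}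
      ; *-assoc = λ x y z → pointwise⇒≃ ((x *ᴿ y) *ᴿ z) (x *ᴿ (y *ᴿ z))
          λ n → ℚ.*-assoc (seq x n) (seq y n) (seq z n)
      ; *-identity =
          (λ x → pointwise⇒≃ (1ℝ *ᴿ x) x λ n → ℚ.*-identityˡ (seq x n))
        , (λ x → pointwise⇒≃ (x *ᴿ 1ℝ) x λ n → ℚ.*-identityʳ (seq x n))
      ; distrib =
          (λ x y z → pointwise⇒≃ (x *ᴿ (y +ᴿ z)) (x *ᴿ y +ᴿ x *ᴿ z)
             λ n → ℚ.*-distribˡ-+ (seq x n) (seq y n) (seq z n))
        , (λ x y z → pointwise⇒≃ ((y +ᴿ z) *ᴿ x) (y *ᴿ x +ᴿ z *ᴿ x)
             λ n → ℚ.*-distribʳ-+ (seq x n) (seq y n) (seq z n))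
      }
    ; *-comm = λ x y → pointwise⇒≃ (x *ᴿ y) (y *ᴿ x)
        λ n → ℚ.*-comm (seq x n) (seq y n)
    }
  }

open Sum (CommutativeRing.+-commutativeMonoid ℝ-commutativeRing) public using (sum)

Matrix : ℕ → Set
Matrix n = Fin n → Fin n → ℝ

_*ᵛ_ : ∀ {n} → Matrix n → Vector ℝ n → Vector ℝ n
(A *ᵛ x) i = sum λ j → A i j *ᴿ x j

-- Only symmetric matrices are considered, so real eigenvalues and real
-- eigenvectors suffice.  A vector is nonzero in the weak (classical) sense.
IsEigenvalue : ∀ {n} → Matrix n → ℝ → Set
IsEigenvalue {n} A μ = ∃ λ (x : Vector ℝ n) →
  ¬ (∀ i → x i ≃ 0ℝ) × (∀ i → (A *ᵛ x) i ≃ μ *ᴿ x i)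

-- The edges form a family indexed by Fin ∣E∣: different indices may carry
-- the same subset, and edges may be empty.
record Hypergraph : Set where
  field
    ∣V∣  : ℕ
    ∣E∣  : ℕ
    edge : Fin ∣E∣ → Subset ∣V∣

record OrientedHypergraph : Set where
  field
    hypergraph : Hypergraph
  open Hypergraph hypergraph public
  field
    -- The irrelevant membership proof restricts σ to the incidences and
    -- makes it a function of the pair (v , e) alone.
    σ : ∀ v e → .(v ∈ edge e) → Sign

module _ (H : Hypergraph) where
  open Hypergraph H

  Linear : Set
  Linear = ∀ e f → e ≢ f → ∣ edge e ∩ edge f ∣ ℕ.≤ 1

  Uniform : ℕ → Set
  Uniform k = ∀ e → ∣ edge e ∣ ≡ k

fromSign : Sign → ℝ
fromSign Sign.+ = 1ℝ
fromSign Sign.- = -ᴿ 1ℝ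

module _ (G : OrientedHypergraph) where
  open OrientedHypergraph G

  sgn : ∀ e v w → .(v ∈ edge e) → .(w ∈ edge e) → Sign
  sgn e v w v∈e w∈e = Sign.opposite (σ v e v∈e Sign.* σ w e w∈e)

  adjacencyTerm : Fin ∣V∣ → Fin ∣V∣ → Fin ∣E∣ → ℝ
  adjacencyTerm v w e with v ∈? edge e | w ∈? edge e
  ... | yes v∈e | yes w∈e = fromSign (sgn e v w v∈e w∈e)
  ... | yes _   | no  _   = 0ℝ
  ... | no  _   | _       = 0ℝ

  adjacencyMatrix : Matrix ∣V∣
  adjacencyMatrix v w with v Fin.≟ w
  ... | yes _ = 0ℝ
  ... | no  _ = sum (adjacencyTerm v w)

module _ (H : Hypergraph) where
  open Hypergraph H

  dualEdge : Fin ∣V∣ → Subset ∣E∣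
  dualEdge v = tabulate λ e → lookup (edge e) v

  ∈-dualEdge⁺ : ∀ {v e} → v ∈ edge e → e ∈ dualEdge v
  ∈-dualEdge⁺ {v} {e} v∈e =
    lookup⇒[]= e (dualEdge v) (trans (lookup∘tabulate _ e) ([]=⇒lookup v∈e))

  ∈-dualEdge⁻ : ∀ {v e} → e ∈ dualEdge v → v ∈ edge e
  ∈-dualEdge⁻ {v} {e} e∈v =
    lookup⇒[]= v (edge e) (trans (sym (lookup∘tabulate _ e)) ([]=⇒lookup e∈v))

dual : OrientedHypergraph → OrientedHypergraph
dual G = record
  { hypergraph = record { ∣V∣ = ∣E∣ ; ∣E∣ = ∣V∣ ; edge = dualEdge hypergraph }
  ; σ = λ e v e∈v → σ v e (∈-dualEdge⁻ hypergraph e∈v)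
  }
  where open OrientedHypergraph G

module _ (G : OrientedHypergraph) where
  open OrientedHypergraph G

  -- An unordered pair {e , f} of distinct edges is represented by the
  -- ordered pair (e , f) with e < f, so each one is listed exactly once.
  IntersectingPair : Fin ∣E∣ × Fin ∣E∣ → Set
  IntersectingPair (e , f) = e Fin.< f × Nonempty (edge e ∩ edge f)

  intersectingPair? : Decidable IntersectingPair
  intersectingPair? (e , f) = (e Fin.<? f) ×-dec nonempty? (edge e ∩ edge f)

  intersectingPairs : List (Fin ∣E∣ × Fin ∣E∣)
  intersectingPairs =
    filter intersectingPair? (cartesianProduct (allFin ∣E∣) (allFin ∣E∣))

  pair : Fin (length intersectingPairs) → Fin ∣E∣ × Fin ∣E∣
  pair = List.lookup intersectingPairs

  pair-intersecting : ∀ i → IntersectingPair (pair i)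
  pair-intersecting i = All.lookup
    (all-filter intersectingPair? (cartesianProduct (allFin ∣E∣) (allFin ∣E∣)))
    (∈-lookup i)

  endpoints : Fin ∣E∣ × Fin ∣E∣ → Subset ∣E∣
  endpoints (e , f) = ⁅ e ⁆ ∪ ⁅ f ⁆

  intersection : Fin ∣E∣ × Fin ∣E∣ → Subset ∣V∣
  intersection (e , f) = edge e ∩ edge f

  commonVertex : Fin (length intersectingPairs) → Fin ∣V∣
  commonVertex i = proj₁ (proj₂ (pair-intersecting i))

  commonVertex-∈ : ∀ i → commonVertex i ∈ intersection (pair i)
  commonVertex-∈ i = proj₂ (proj₂ (pair-intersecting i))

  ∈-endpoint : ∀ p {v g} → v ∈ intersection p → g ∈ endpoints p → v ∈ edge g
  ∈-endpoint (e , f) v∈ g∈ with x∈p∩q⁻ (edge e) (edge f) v∈ | x∈p∪q⁻ ⁅ e ⁆ ⁅ f ⁆ g∈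
  ... | v∈e , v∈f | inj₁ g∈e rewrite x∈⁅y⁆⇒x≡y e g∈e = v∈e
  ... | v∈e , v∈f | inj₂ g∈f rewrite x∈⁅y⁆⇒x≡y f g∈f = v∈f

  -- Linearity is what makes the orientation independent of the common
  -- vertex chosen for each pair; see Λ-σ.
  Λ : Linear hypergraph → OrientedHypergraph
  Λ _ = record
    { hypergraph = record
      { ∣V∣  = ∣E∣
      ; ∣E∣  = length intersectingPairs
      ; edge = λ i → endpoints (pair i)
      }
    ; σ = λ g i g∈ →
        σ (commonVertex i) g (∈-endpoint (pair i) (commonVertex-∈ i) g∈)
    }

  ∣p∣≤1⇒unique : ∀ {n} (p : Subset n) {x y} → ∣ p ∣ ℕ.≤ 1 → x ∈ p → y ∈ p → x ≡ y
  ∣p∣≤1⇒unique p {x} {y} ∣p∣≤1 x∈p y∈p with x Fin.≟ y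
  ... | yes x≡y = x≡y
  ... | no  x≢y = contradiction ∣p∣≤1 (ℕ.<⇒≱
    (subst (ℕ._< ∣ p ∣) (∣⁅x⁆∣≡1 x) (p⊂q⇒∣p∣<∣q∣
      ( (λ z∈ → subst (_∈ p) (sym (x∈⁅y⁆⇒x≡y x z∈)) x∈p)
      , y , y∈p , λ y∈ → x≢y (sym (x∈⁅y⁆⇒x≡y x y∈))))))

  Λ-σ : (linear : Linear hypergraph) →
        ∀ i v (v∈ : v ∈ intersection (pair i)) g (g∈ : g ∈ endpoints (pair i)) →
        OrientedHypergraph.σ (Λ linear) g i g∈ ≡ σ v g (∈-endpoint (pair i) v∈ g∈)
  Λ-σ linear i v v∈ g g∈ = σ-cong
    (∣p∣≤1⇒unique (intersection (pair i))
      (linear _ _ (Fin.<⇒≢ (proj₁ (pair-intersecting i)))) (commonVertex-∈ i) v∈)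
    where
    σ-cong : ∀ {w} .{w∈ : w ∈ edge g} .{v∈ : v ∈ edge g} →
             w ≡ v → σ w g w∈ ≡ σ v g v∈
    σ-cong refl = refl

{-# OPTIONS --safe #-}
module Submission where

-- Let N be the incidence matrix of G*, with rows indexed by the edges of G.
-- Distinct rows have inner product −a_ef, and each row has k entries ±1, so
-- A(G*) + N Nᵀ = k I.  If A x = μ x, then μ |x|² + |Nᵀ x|² = k |x|², which
-- for x ≠ 0 excludes μ > k.  For linear G the matrices A(Λ(G)) and A(G*)
-- coincide: two edges meet in at most one vertex and are then joined by
-- exactly one edge of Λ(G).

open import Defs
open import Algebra.Bundles using (CommutativeRing)
import Algebra.Properties.CommutativeMonoid.Sum as CommutativeMonoidSum
import Algebra.Properties.CommutativeSemigroup as CommutativeSemigroupProperties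
import Algebra.Properties.Semiring.Sum as SemiringSum
open import Data.Fin using (Fin; zero; suc)
import Data.Fin as Fin
import Data.Fin.Properties as Fin
open import Data.Fin.Subset using (Subset; _∈_; _∉_; _∩_; ⁅_⁆; ∣_∣; Nonempty; inside; outside)
open import Data.Fin.Subset.Properties
  using (_∈?_; nonempty?; x∈p∩q⁺; x∈p∩q⁻; x∈p∪q⁺; x∈p∪q⁻; x∈⁅x⁆; x∈⁅y⁆⇒x≡y; drop-there)
open import Data.Integer using (+_)
import Data.Integer as ℤ
import Data.Integer.Properties as ℤ
open import Data.List using (List)
import Data.List as List
open import Data.List.Membership.Propositional.Properties
  using (∈-lookup; ∈-filter⁺; ∈-cartesianProduct⁺; ∈-allFin)
import Data.List.Relation.Unary.All as All
open import Data.List.Relation.Unary.AllPairs using (_∷_)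
open import Data.List.Relation.Unary.Any using (index)
open import Data.List.Relation.Unary.Any.Properties using (lookup-index)
open import Data.List.Relation.Unary.Unique.Propositional using (Unique)
open import Data.List.Relation.Unary.Unique.Propositional.Properties
  using (filter⁺; cartesianProduct⁺; allFin⁺)
open import Data.Nat using (ℕ; zero; suc)
import Data.Nat as ℕ
import Data.Nat.Properties as ℕ
open import Data.Product using (∃-syntax; _×_; _,_; proj₁; proj₂)
open import Data.Rational as ℚ using (ℚ; 0ℚ; 1ℚ; ½; _+_; _*_; -_; _-_; _<_; _≤_)
  renaming (∣_∣ to abs)
import Data.Rational.Properties as ℚ
import Data.Rational.Unnormalised as ℚᵘ
import Data.Rational.Unnormalised.Properties as ℚᵘ
open import Data.Rational.Solver using (module +-*-Solver)
import Data.Sign as Sign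
open import Data.Sum using (_⊎_; inj₁; inj₂)
open import Data.Vec using ([]; _∷_; here; there)
open import Data.Vec.Functional using (Vector)
open import Function using (_∘_)
open import Relation.Binary.Definitions using (tri<; tri≈; tri>)
open import Relation.Binary.PropositionalEquality
  using (_≡_; _≢_; refl; sym; trans; cong; cong₂; subst)
open import Relation.Binary.Structures using (IsEquivalence)
import Relation.Binary.Reasoning.Setoid as SetoidReasoning
open import Relation.Nullary using (¬_; Dec; yes; no; contradiction)

-- Sums in commutative rings

-- Over an abstract ring `_≈_` does not unfold, so the endpoints of equational steps can be
-- inferred; over `ℝ` they would have to be written out.
module RingSum {c ℓ} (R : CommutativeRing c ℓ) where
  private module R = CommutativeRing R
  open CommutativeRing R
    using (Carrier; _≈_; 0#; +-congˡ; +-congʳ; *-congˡ; *-congʳ)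
    renaming (_+_ to _⊕_; _*_ to _⊗_)
  open SemiringSum R.semiring
    using (sum-cong-≋; sum-replicate-zero; ∑-distrib-+; ∑-comm;
           *-distribˡ-sum; *-distribʳ-sum)
  open CommutativeMonoidSum R.+-commutativeMonoid using () renaming (sum to ∑)
  open CommutativeSemigroupProperties R.*-commutativeSemigroup using (x∙yz≈y∙xz)
  open SetoidReasoning R.setoid

  sum-zero : ∀ {n} (t : Vector Carrier n) → (∀ i → t i ≈ 0#) → ∑ t ≈ 0#
  sum-zero {n} t t≈0 = R.trans (sum-cong-≋ t≈0) (sum-replicate-zero n)

  sum-cancel : ∀ {n} (t u : Vector Carrier n) → (∀ i → t i ⊕ u i ≈ 0#) → ∑ t ⊕ ∑ u ≈ 0#
  sum-cancel t u t+u≈0 =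
    R.trans (R.sym (∑-distrib-+ t u)) (sum-zero (λ i → t i ⊕ u i) t+u≈0)

  sum-single : ∀ {n} (t : Vector Carrier n) i → (∀ j → j ≢ i → t j ≈ 0#) → ∑ t ≈ t i
  sum-single t zero    t≈0 =
    R.trans (+-congˡ (sum-zero (t ∘ suc) λ j → t≈0 (suc j) λ ())) (R.+-identityʳ _)
  sum-single t (suc i) t≈0 = R.trans
    (R.+-cong (t≈0 zero λ ())
      (sum-single (t ∘ suc) i λ j j≢i → t≈0 (suc j) (j≢i ∘ Fin.suc-injective)))
    (R.+-identityˡ _)

  -- Matrices with A + N Nᵀ = d I

  transposeApply : ∀ {n m} → (Fin n → Fin m → Carrier) → Vector Carrier n → Vector Carrier m
  transposeApply N x v = ∑ λ j → N j v ⊗ x j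

  module _ {n m : ℕ} (A : Fin n → Fin n → Carrier) (N : Fin n → Fin m → Carrier) (d : Carrier)
    (diagonal    : ∀ i → A i i ⊕ ∑ (λ v → N i v ⊗ N i v) ≈ d)
    (offDiagonal : ∀ i j → i ≢ j → A i j ⊕ ∑ (λ v → N i v ⊗ N j v) ≈ 0#)
    where

    private
      gram : Fin n → Fin n → Carrier
      gram i j = ∑ λ v → N i v ⊗ N j v

    -- Associativity N (Nᵀ x) = (N Nᵀ) x, by exchanging the two summations.
    gram-apply : ∀ x i → ∑ (λ v → N i v ⊗ transposeApply N x v) ≈ ∑ (λ j → gram i j ⊗ x j)
    gram-apply x i = begin
      ∑ (λ v → N i v ⊗ transposeApply N x v)
        ≈⟨ sum-cong-≋ (λ v → *-distribˡ-sum (N i v) (λ j → N j v ⊗ x j)) ⟩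
      ∑ (λ v → ∑ (λ j → N i v ⊗ (N j v ⊗ x j)))
        ≈⟨ ∑-comm (λ v j → N i v ⊗ (N j v ⊗ x j)) ⟩
      ∑ (λ j → ∑ (λ v → N i v ⊗ (N j v ⊗ x j)))
        ≈⟨ sum-cong-≋ (λ j → sum-cong-≋ (λ v → R.*-assoc (N i v) (N j v) (x j))) ⟨
      ∑ (λ j → ∑ (λ v → (N i v ⊗ N j v) ⊗ x j))
        ≈⟨ sum-cong-≋ (λ j → *-distribʳ-sum (x j) (λ v → N i v ⊗ N j v)) ⟨
      ∑ (λ j → gram i j ⊗ x j) ∎

    -- The module hypotheses say entrywise that A + N Nᵀ = d I, so in row `i` of (A + N Nᵀ) x only
    -- the summand `j = i` survives.
    shifted-row : ∀ x i →
      ∑ (λ j → A i j ⊗ x j) ⊕ ∑ (λ v → N i v ⊗ transposeApply N x v) ≈ d ⊗ x i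
    shifted-row x i = begin
      ∑ (λ j → A i j ⊗ x j) ⊕ ∑ (λ v → N i v ⊗ transposeApply N x v)
        ≈⟨ +-congˡ (gram-apply x i) ⟩
      ∑ (λ j → A i j ⊗ x j) ⊕ ∑ (λ j → gram i j ⊗ x j)
        ≈⟨ ∑-distrib-+ (λ j → A i j ⊗ x j) (λ j → gram i j ⊗ x j) ⟨
      ∑ (λ j → A i j ⊗ x j ⊕ gram i j ⊗ x j)
        ≈⟨ sum-cong-≋ (λ j → R.distribʳ (x j) (A i j) (gram i j)) ⟨
      ∑ (λ j → (A i j ⊕ gram i j) ⊗ x j)
        ≈⟨ sum-single (λ j → (A i j ⊕ gram i j) ⊗ x j) i
            (λ j j≢i → R.trans (*-congʳ (offDiagonal i j (j≢i ∘ sym))) (R.zeroˡ (x j))) ⟩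
      (A i i ⊕ gram i i) ⊗ x i
        ≈⟨ *-congʳ (diagonal i) ⟩
      d ⊗ x i ∎

    -- Pair `shifted-row` with `x`: the term x · A x becomes μ |x|², and x · N Nᵀ x is |Nᵀ x|². The
    -- witness `y` is Nᵀ x; for the bound it only matters that its contribution is a sum of squares.
    eigenvector-identity : (x : Vector Carrier n) (μ : Carrier) →
      (∀ i → ∑ (λ j → A i j ⊗ x j) ≈ μ ⊗ x i) →
      ∃[ y ] μ ⊗ ∑ (λ i → x i ⊗ x i) ⊕ ∑ {m} (λ v → y v ⊗ y v) ≈ d ⊗ ∑ (λ i → x i ⊗ x i)
    eigenvector-identity x μ Ax≈μx = transposeApply N x , (begin
      μ ⊗ ∑ (λ i → x i ⊗ x i) ⊕ ∑ (λ v → y v ⊗ y v)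
        ≈⟨ R.+-cong (scale μ) squares ⟩
      ∑ (λ i → x i ⊗ (μ ⊗ x i)) ⊕ ∑ (λ i → x i ⊗ ∑ (λ v → N i v ⊗ y v))
        ≈⟨ ∑-distrib-+ (λ i → x i ⊗ (μ ⊗ x i)) (λ i → x i ⊗ ∑ (λ v → N i v ⊗ y v)) ⟨
      ∑ (λ i → x i ⊗ (μ ⊗ x i) ⊕ x i ⊗ ∑ (λ v → N i v ⊗ y v))
        ≈⟨ sum-cong-≋ (λ i → R.distribˡ (x i) (μ ⊗ x i) (∑ (λ v → N i v ⊗ y v))) ⟨
      ∑ (λ i → x i ⊗ (μ ⊗ x i ⊕ ∑ (λ v → N i v ⊗ y v)))
        ≈⟨ sum-cong-≋ (λ i → *-congˡ (R.trans (+-congʳ (R.sym (Ax≈μx i))) (shifted-row x i))) ⟩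
      ∑ (λ i → x i ⊗ (d ⊗ x i))
        ≈⟨ scale d ⟨
      d ⊗ ∑ (λ i → x i ⊗ x i) ∎)
      where
      y = transposeApply N x
      scale : ∀ a → a ⊗ ∑ (λ i → x i ⊗ x i) ≈ ∑ (λ i → x i ⊗ (a ⊗ x i))
      scale a = R.trans (*-distribˡ-sum a (λ i → x i ⊗ x i))
        (sum-cong-≋ λ i → x∙yz≈y∙xz a (x i) (x i))
      squares : ∑ (λ v → y v ⊗ y v) ≈ ∑ (λ i → x i ⊗ ∑ (λ v → N i v ⊗ y v))
      squares = begin
        ∑ (λ v → y v ⊗ y v)
          ≈⟨ sum-cong-≋ (λ v → *-distribʳ-sum (y v) (λ i → N i v ⊗ x i)) ⟩
        ∑ (λ v → ∑ (λ i → (N i v ⊗ x i) ⊗ y v))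
          ≈⟨ ∑-comm (λ v i → (N i v ⊗ x i) ⊗ y v) ⟩
        ∑ (λ i → ∑ (λ v → (N i v ⊗ x i) ⊗ y v))
          ≈⟨ sum-cong-≋ (λ i → sum-cong-≋ (λ v →
              R.trans (*-congʳ (R.*-comm (N i v) (x i))) (R.*-assoc (x i) (N i v) (y v)))) ⟩
        ∑ (λ i → ∑ (λ v → x i ⊗ (N i v ⊗ y v)))
          ≈⟨ sum-cong-≋ (λ i → *-distribˡ-sum (x i) (λ v → N i v ⊗ y v)) ⟨
        ∑ (λ i → x i ⊗ ∑ (λ v → N i v ⊗ y v)) ∎

open RingSum ℝ-commutativeRing using (sum-zero; sum-cancel; sum-single; eigenvector-identity)

-- Order on the reals

abs-square : ∀ p → abs p * abs p ≡ p * p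
abs-square p with ℚ.∣p∣≡p∨∣p∣≡-p p
... | inj₁ eq = cong₂ _*_ eq eq
... | inj₂ eq = trans (cong₂ _*_ eq eq) (solve 1 (λ p → (:- p) :* (:- p) := p :* p) refl p)
  where open +-*-Solver

0≤p*p : ∀ p → 0ℚ ≤ p * p
0≤p*p p = subst (0ℚ ≤_) (abs-square p) (ℚ.nonNegative⁻¹ (abs p * abs p)
  {{ℚ.nonNeg*nonNeg⇒nonNeg (abs p) {{ℚ.∣-∣-nonNeg p}} (abs p) {{ℚ.∣-∣-nonNeg p}}}})

p≤∣p∣ : ∀ p → p ≤ abs p
p≤∣p∣ p with ℚ.≤-total 0ℚ p
... | inj₁ 0≤p = ℚ.≤-reflexive (sym (ℚ.0≤p⇒∣p∣≡p 0≤p))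
... | inj₂ p≤0 = ℚ.≤-trans p≤0 (ℚ.0≤∣p∣ p)

p≤p+q : ∀ p q → 0ℚ ≤ q → p ≤ p + q
p≤p+q p q 0≤q = subst (_≤ p + q) (ℚ.+-identityʳ p) (ℚ.+-monoʳ-≤ p {0ℚ} {q} 0≤q)

p≤q+p : ∀ p q → 0ℚ ≤ q → p ≤ q + p
p≤q+p p q 0≤q = subst (p ≤_) (ℚ.+-comm p q) (p≤p+q p q 0≤q)

0≤p+q : ∀ p q → 0ℚ ≤ p → 0ℚ ≤ q → 0ℚ ≤ p + q
0≤p+q p q 0≤p 0≤q = ℚ.≤-trans 0≤p (p≤p+q p q 0≤q)

p-q<r⇒p<q+r : ∀ p q r → p - q < r → p < q + r
p-q<r⇒p<q+r p q r p-q<r =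
  subst (_< q + r) (solve 2 (λ p q → q :+ (p :- q) := p) refl p q) (ℚ.+-monoʳ-< q p-q<r)
  where open +-*-Solver

p*p<q*q⇒∣p∣<q : ∀ p q → 0ℚ < q → p * p < q * q → abs p < q
p*p<q*q⇒∣p∣<q p q 0<q p²<q² = ℚ.≰⇒> λ q≤∣p∣ → ℚ.<-irrefl refl (ℚ.<-≤-trans p²<q² (begin
  q * q          ≤⟨ ℚ.*-monoˡ-≤-nonNeg q {{ℚ.nonNegative (ℚ.<⇒≤ 0<q)}} q≤∣p∣ ⟩
  q * abs p      ≤⟨ ℚ.*-monoʳ-≤-nonNeg (abs p) {{ℚ.∣-∣-nonNeg p}} q≤∣p∣ ⟩
  abs p * abs p  ≡⟨ abs-square p ⟩
  p * p          ∎))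
  where open ℚ.≤-Reasoning

0<p*q : ∀ {p q} → 0ℚ < p → 0ℚ < q → 0ℚ < p * q
0<p*q {p} {q} 0<p 0<q =
  ℚ.positive⁻¹ (p * q) {{ℚ.pos*pos⇒pos p {{ℚ.positive 0<p}} q {{ℚ.positive 0<q}}}}

-- A Cauchy sequence that exceeds q + ε/2 at one late index stays above q + ε/4
-- from there on, so a single rational comparison decides which case holds.
¬eventually-above⇒≤ᴿ : ∀ x q →
  (∀ δ → 0ℚ < δ → ¬ (∃[ N ] ∀ n → N ℕ.≤ n → q + δ ≤ seq x n)) → x ≤ᴿ const q
¬eventually-above⇒≤ᴿ x q ¬above ε 0<ε = decide (cauchy x η 0<η)
  where
  open ℚ.≤-Reasoning
  open +-*-Solver
  -- A quarter of `ε`: in the `yes` case a drift of `η` fits into the remaining half of `ε`; in the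
  -- `no` case losing `η` from that half still leaves the gap `η` that `¬above` refutes.
  η = ½ * (½ * ε)
  0<η : 0ℚ < η
  0<η = 0<p*q (ℚ.positive⁻¹ ½) (0<p*q (ℚ.positive⁻¹ ½) 0<ε)
  η<½ε : η < ½ * ε
  η<½ε = begin-strict
    η      ≡⟨ ℚ.+-identityʳ η ⟨
    η + 0ℚ <⟨ ℚ.+-monoʳ-< η 0<η ⟩
    η + η  ≡⟨ solve 1 (λ ε → con ½ :* (con ½ :* ε) :+ con ½ :* (con ½ :* ε) := con ½ :* ε) refl ε ⟩
    ½ * ε  ∎
  decide : (∃[ N ] ∀ m n → N ℕ.≤ m → N ℕ.≤ n → abs (seq x m - seq x n) < η) →
    ∃[ N ] ∀ n → N ℕ.≤ n → seq x n ≤ q + ε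
  decide (N , close) with seq x N ℚ.≤? q + ½ * ε
  ... | yes xN≤ = N , λ n N≤n → ℚ.<⇒≤ (begin-strict
    seq x n            <⟨ p-q<r⇒p<q+r (seq x n) (seq x N) η
                            (ℚ.≤-<-trans (p≤∣p∣ (seq x n - seq x N)) (close n N N≤n ℕ.≤-refl)) ⟩
    seq x N + η        ≤⟨ ℚ.+-monoˡ-≤ η xN≤ ⟩
    q + ½ * ε + η      <⟨ ℚ.+-monoʳ-< (q + ½ * ε) η<½ε ⟩
    q + ½ * ε + ½ * ε  ≡⟨ solve 2 (λ q ε → q :+ con ½ :* ε :+ con ½ :* ε := q :+ ε) refl q ε ⟩
    q + ε              ∎)
  ... | no xN≰ = contradiction (N , λ n N≤n → ℚ.<⇒≤ (begin-strict
    q + η              ≡⟨ solve 2 (λ q ε → q :+ con ½ :* (con ½ :* ε)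
                            := q :+ con ½ :* ε :- con ½ :* (con ½ :* ε)) refl q ε ⟩
    q + ½ * ε - η      <⟨ ℚ.+-monoˡ-< (- η) (ℚ.≰⇒> xN≰) ⟩
    seq x N - η        <⟨ ℚ.+-monoˡ-< (- η) (p-q<r⇒p<q+r (seq x N) (seq x n) η
                            (ℚ.≤-<-trans (p≤∣p∣ (seq x N - seq x n)) (close N n ℕ.≤-refl N≤n))) ⟩
    seq x n + η - η    ≡⟨ solve 2 (λ x η → x :+ η :- η := x) refl (seq x n) η ⟩
    seq x n            ∎)) (¬above η 0<η)

-- Sums of squares and the eigenvalue bound

sum-nonNeg : ∀ {m} (t : Vector ℝ m) n → (∀ i → 0ℚ ≤ seq (t i) n) → 0ℚ ≤ seq (sum t) n
sum-nonNeg {zero}  t n 0≤t = ℚ.≤-refl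
sum-nonNeg {suc m} t n 0≤t =
  0≤p+q (seq (t zero) n) (seq (sum (t ∘ suc)) n) (0≤t zero) (sum-nonNeg (t ∘ suc) n (0≤t ∘ suc))

term≤sum : ∀ {m} (t : Vector ℝ m) n → (∀ i → 0ℚ ≤ seq (t i) n) →
  ∀ i → seq (t i) n ≤ seq (sum t) n
term≤sum t n 0≤t zero    =
  p≤p+q (seq (t zero) n) (seq (sum (t ∘ suc)) n) (sum-nonNeg (t ∘ suc) n (0≤t ∘ suc))
term≤sum t n 0≤t (suc i) = ℚ.≤-trans (term≤sum (t ∘ suc) n (0≤t ∘ suc) i)
  (p≤q+p (seq (sum (t ∘ suc)) n) (seq (t zero) n) (0≤t zero))

square-squeeze : ∀ p s ε → 0ℚ < ε → p * p ≤ s → abs (s - 0ℚ) < ε * ε → abs (p - 0ℚ) < ε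
square-squeeze p s ε 0<ε p²≤s s<ε² = subst (λ t → abs t < ε) (sym (ℚ.+-identityʳ p))
  (p*p<q*q⇒∣p∣<q p ε 0<ε (ℚ.≤-<-trans p²≤s (ℚ.≤-<-trans (p≤∣p∣ s)
    (subst (λ t → abs t < ε * ε) (ℚ.+-identityʳ s) s<ε²))))

-- Each square is at most the whole sum, so making the sum smaller than `ε * ε` makes every entry
-- smaller than `ε`.
squares-vanish : ∀ {m} (x : Vector ℝ m) → sum (λ i → x i *ᴿ x i) ≃ 0ℝ → ∀ i → x i ≃ 0ℝ
squares-vanish {m} x S≃0 i ε 0<ε =
  let N , small = S≃0 (ε * ε) (0<p*q 0<ε 0<ε)
  in N , λ n N≤n → square-squeeze (seq (x i) n) (seq (sum squares) n) ε 0<ε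
       (term≤sum squares n (λ j → 0≤p*p (seq (x j) n)) i) (small n N≤n)
  where
  squares : Vector ℝ m
  squares j = x j *ᴿ x j

-- With nonnegative `s` and `t`, δ s ≤ (m - q) s ≤ m s + t - q s. The last quantity is below
-- `δ * ε`, and `δ` cancels.
gap-squeeze : ∀ m q δ s t ε → 0ℚ < δ → q + δ ≤ m → 0ℚ ≤ s → 0ℚ ≤ t →
  abs (m * s + t - q * s) < δ * ε → abs (s - 0ℚ) < ε
gap-squeeze m q δ s t ε 0<δ q+δ≤m 0≤s 0≤t small =
  subst (_< ε) (sym (trans (cong abs (ℚ.+-identityʳ s)) (ℚ.0≤p⇒∣p∣≡p 0≤s)))
    (ℚ.*-cancelˡ-<-nonNeg δ {{ℚ.nonNegative (ℚ.<⇒≤ 0<δ)}} (begin-strict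
      δ * s                      ≡⟨ solve 3 (λ q δ s → δ :* s := (q :+ δ) :* s :- q :* s) refl q δ s ⟩
      (q + δ) * s - q * s        ≤⟨ ℚ.+-monoˡ-≤ (- (q * s)) (ℚ.*-monoʳ-≤-nonNeg s {{ℚ.nonNegative 0≤s}} q+δ≤m) ⟩
      m * s - q * s              ≤⟨ ℚ.+-monoˡ-≤ (- (q * s)) (p≤p+q (m * s) t 0≤t) ⟩
      m * s + t - q * s          ≤⟨ p≤∣p∣ (m * s + t - q * s) ⟩
      abs (m * s + t - q * s)    <⟨ small ⟩
      δ * ε                      ∎))
  where
  open ℚ.≤-Reasoning
  open +-*-Solver

-- A uniform gap `δ` between `μ` and `q` turns the identity for |x|² and |Nᵀ x|² into smallness of
-- |x|²: tolerance `δ * ε` in the identity gives tolerance `ε` for `S`.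
vanishes-if-above : ∀ μ q δ S Q → 0ℚ < δ →
  (∃[ N ] ∀ n → N ℕ.≤ n → q + δ ≤ seq μ n) →
  (∀ n → 0ℚ ≤ seq S n) → (∀ n → 0ℚ ≤ seq Q n) →
  μ *ᴿ S +ᴿ Q ≃ const q *ᴿ S → S ≃ 0ℝ
vanishes-if-above μ q δ S Q 0<δ (N , above) 0≤S 0≤Q eq ε 0<ε =
  let M , close = eq (δ * ε) (0<p*q 0<δ 0<ε)
  in N ℕ.⊔ M , λ n ≤n → gap-squeeze (seq μ n) q δ (seq S n) (seq Q n) ε 0<δ
       (above n (ℕ.m⊔n≤o⇒m≤o N M ≤n)) (0≤S n) (0≤Q n) (close n (ℕ.m⊔n≤o⇒n≤o N M ≤n))

-- The eigenvector is nonzero only in the negated sense, so it can yield nothing but a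
-- contradiction. Hence the bound goes through `¬eventually-above⇒≤ᴿ`: if `μ` stayed above `q + δ`,
-- the sum of the squares of `x`, and then `x` itself, would vanish.
eigenvalue-bound : ∀ {n m} (A : Matrix n) (N : Fin n → Fin m → ℝ) q →
  (∀ i → A i i +ᴿ sum (λ v → N i v *ᴿ N i v) ≃ const q) →
  (∀ i j → i ≢ j → A i j +ᴿ sum (λ v → N i v *ᴿ N j v) ≃ 0ℝ) →
  ∀ μ → IsEigenvalue A μ → μ ≤ᴿ const q
eigenvalue-bound {n} {m} A N q diagonal offDiagonal μ (x , x≄0 , Ax≃μx) =
  ¬eventually-above⇒≤ᴿ μ q λ δ 0<δ above →
    let y , identity = eigenvector-identity A N (const q) diagonal offDiagonal x μ Ax≃μx
    in contradicts δ 0<δ above y identity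
  where
  contradicts : ∀ δ → 0ℚ < δ → (∃[ M ] ∀ l → M ℕ.≤ l → q + δ ≤ seq μ l) →
    (y : Vector ℝ m) →
    ¬ (μ *ᴿ sum (λ i → x i *ᴿ x i) +ᴿ sum (λ v → y v *ᴿ y v) ≃ const q *ᴿ sum (λ i → x i *ᴿ x i))
  contradicts δ 0<δ above y identity =
    let S≃0 = vanishes-if-above μ q δ (sum λ i → x i *ᴿ x i) (sum λ v → y v *ᴿ y v) 0<δ above
                (λ l → sum-nonNeg (λ i → x i *ᴿ x i) l λ i → 0≤p*p (seq (x i) l))
                (λ l → sum-nonNeg (λ v → y v *ᴿ y v) l λ v → 0≤p*p (seq (y v) l))
                identity
        x≃0 = squares-vanish x S≃0
    in x≄0 x≃0

-- Cardinalities as sums of reals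

fromℕ-suc : ∀ k → fromℕ (suc k) ≃ 1ℝ +ᴿ fromℕ k
-- The fraction `+ k ℚ./ 1` is normalised by a gcd that is stuck for variable `k`; unnormalised
-- rationals avoid this.
fromℕ-suc k = pointwise⇒≃ (fromℕ (suc k)) (1ℝ +ᴿ fromℕ k) λ _ → ℚ.toℚᵘ-injective (begin
  ℚ.toℚᵘ (+ suc k ℚ./ 1)             ≈⟨ ℚ.toℚᵘ-fromℚᵘ (ℚᵘ.mkℚᵘ (+ suc k) 0) ⟩
  ℚᵘ.mkℚᵘ (+ suc k) 0                ≈⟨ ℚᵘ.≃-reflexive (cong (λ i → ℚᵘ.mkℚᵘ i 0) (sym (ℤ.*-identityʳ (+ 1 ℤ.+ + k)))) ⟩
  ℚᵘ.mkℚᵘ ((+ 1 ℤ.+ + k) ℤ.* + 1) 0  ≈⟨ ℚᵘ.*≡* (cong (ℤ._* + 1) (ℤ.*-distribʳ-+ (+ 1) (+ 1) (+ k))) ⟩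
  ℚᵘ.1ℚᵘ ℚᵘ.+ ℚᵘ.mkℚᵘ (+ k) 0        ≈⟨ ℚᵘ.+-congʳ ℚᵘ.1ℚᵘ (ℚ.toℚᵘ-fromℚᵘ (ℚᵘ.mkℚᵘ (+ k) 0)) ⟨
  ℚᵘ.1ℚᵘ ℚᵘ.+ ℚ.toℚᵘ (+ k ℚ./ 1)     ≈⟨ ℚ.toℚᵘ-homo-+ 1ℚ (+ k ℚ./ 1) ⟨
  ℚ.toℚᵘ (1ℚ + + k ℚ./ 1)            ∎)
  where open SetoidReasoning ℚᵘ.≃-setoid

-- The endpoints are explicit here: Agda cannot infer them, because _≃_ unfolds.

≃-reflexive : ∀ x y → x ≡ y → x ≃ y
≃-reflexive x .x refl = IsEquivalence.refl ≃-isEquivalence {x}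

≃-sym : ∀ x y → x ≃ y → y ≃ x
≃-sym x y = IsEquivalence.sym ≃-isEquivalence {x} {y}

≃-trans : ∀ x y z → x ≃ y → y ≃ z → x ≃ z
≃-trans x y z = IsEquivalence.trans ≃-isEquivalence {x} {y} {z}

sum-indicator : ∀ {n} (p : Subset n) (t : Vector ℝ n) →
  (∀ i → i ∈ p → t i ≃ 1ℝ) → (∀ i → i ∉ p → t i ≃ 0ℝ) → sum t ≃ fromℕ ∣ p ∣
sum-indicator [] t t≃1 t≃0 = ≃-reflexive 0ℝ 0ℝ refl
sum-indicator (s ∷ p) t t≃1 t≃0 = step s (t≃1 zero) (t≃0 zero)
  where
  tail : sum (t ∘ suc) ≃ fromℕ ∣ p ∣
  tail = sum-indicator p (t ∘ suc) (λ i → t≃1 (suc i) ∘ there)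
    (λ i i∉p → t≃0 (suc i) (i∉p ∘ drop-there))
  step : ∀ s → (zero ∈ s ∷ p → t zero ≃ 1ℝ) → (zero ∉ s ∷ p → t zero ≃ 0ℝ) →
         t zero +ᴿ sum (t ∘ suc) ≃ fromℕ ∣ s ∷ p ∣
  step inside t₀≃1 _ =
    ≃-trans (t zero +ᴿ sum (t ∘ suc)) (1ℝ +ᴿ fromℕ ∣ p ∣) (fromℕ (suc ∣ p ∣))
      (+ᴿ-cong {t zero} {1ℝ} {sum (t ∘ suc)} {fromℕ ∣ p ∣} (t₀≃1 here) tail)
      (≃-sym (fromℕ (suc ∣ p ∣)) (1ℝ +ᴿ fromℕ ∣ p ∣) (fromℕ-suc ∣ p ∣))
  step outside _ t₀≃0 =
    ≃-trans (t zero +ᴿ sum (t ∘ suc)) (0ℝ +ᴿ fromℕ ∣ p ∣) (fromℕ ∣ p ∣)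
      (+ᴿ-cong {t zero} {0ℝ} {sum (t ∘ suc)} {fromℕ ∣ p ∣} (t₀≃0 λ ()) tail)
      (pointwise⇒≃ (0ℝ +ᴿ fromℕ ∣ p ∣) (fromℕ ∣ p ∣) λ _ → ℚ.+-identityˡ (+ ∣ p ∣ ℚ./ 1))

-- Signed incidence matrices

fromSign-cancel : ∀ s t → fromSign (Sign.opposite (s Sign.* t)) +ᴿ fromSign s *ᴿ fromSign t ≃ 0ℝ
fromSign-cancel s t =
  pointwise⇒≃ (fromSign (Sign.opposite (s Sign.* t)) +ᴿ fromSign s *ᴿ fromSign t) 0ℝ (cancel s t)
  where
  cancel : ∀ s t n →
    seq (fromSign (Sign.opposite (s Sign.* t)) +ᴿ fromSign s *ᴿ fromSign t) n ≡ 0ℚ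
  cancel Sign.+ Sign.+ n = refl
  cancel Sign.+ Sign.- n = refl
  cancel Sign.- Sign.+ n = refl
  cancel Sign.- Sign.- n = refl

fromSign² : ∀ s → fromSign s *ᴿ fromSign s ≃ 1ℝ
fromSign² Sign.+ = pointwise⇒≃ (1ℝ *ᴿ 1ℝ) 1ℝ λ _ → refl
fromSign² Sign.- = pointwise⇒≃ (-ᴿ 1ℝ *ᴿ -ᴿ 1ℝ) 1ℝ λ _ → refl

-- A with-abstraction normalises its goal, and the normal form of a sum of reals
-- is huge; SumOf keeps the sum out of the goal.
data SumOf {n : ℕ} (t : Vector ℝ n) : ℝ → Set where
  sumOf : SumOf t (sum t)

SumOf⇒≡ : ∀ {n} {t : Vector ℝ n} {r} → SumOf t r → r ≡ sum t
SumOf⇒≡ sumOf = refl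

module _ (G : OrientedHypergraph) where
  open OrientedHypergraph G

  incidence : Fin ∣V∣ → Fin ∣E∣ → ℝ
  incidence v e with v ∈? edge e
  ... | yes v∈e = fromSign (σ v e v∈e)
  ... | no  _   = 0ℝ

  adjacencyTerm-∈ : ∀ {v w e} (v∈e : v ∈ edge e) (w∈e : w ∈ edge e) →
    adjacencyTerm G v w e ≡ fromSign (sgn G e v w v∈e w∈e)
  adjacencyTerm-∈ {v} {w} {e} v∈e w∈e with v ∈? edge e | w ∈? edge e
  ... | yes _   | yes _   = refl
  ... | yes _   | no  w∉e = contradiction w∈e w∉e
  ... | no  v∉e | _       = contradiction v∈e v∉e

  adjacencyTerm-∉ : ∀ {v w e} → ¬ (v ∈ edge e × w ∈ edge e) → adjacencyTerm G v w e ≡ 0ℝ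
  adjacencyTerm-∉ {v} {w} {e} ∉e with v ∈? edge e | w ∈? edge e
  ... | yes v∈e | yes w∈e = contradiction (v∈e , w∈e) ∉e
  ... | yes _   | no  _   = refl
  ... | no  _   | _       = refl

  -- The minus sign in `sgn` makes the term the negative of the product of the two incidences. If a
  -- vertex is missing from `e`, both summands are zero. Summed over `e`, this gives the
  -- off-diagonal entries of A + N Nᵀ.
  adjacencyTerm-cancel : ∀ v w e →
    adjacencyTerm G v w e +ᴿ incidence v e *ᴿ incidence w e ≃ 0ℝ
  adjacencyTerm-cancel v w e with v ∈? edge e | w ∈? edge e
  ... | yes v∈e | yes w∈e = fromSign-cancel (σ v e v∈e) (σ w e w∈e)
  ... | yes v∈e | no  _   = pointwise⇒≃ (0ℝ +ᴿ fromSign (σ v e v∈e) *ᴿ 0ℝ) 0ℝ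
    λ n → trans (ℚ.+-identityˡ _) (ℚ.*-zeroʳ (seq (fromSign (σ v e v∈e)) n))
  ... | no  _   | yes w∈e = pointwise⇒≃ (0ℝ +ᴿ 0ℝ *ᴿ fromSign (σ w e w∈e)) 0ℝ
    λ n → trans (ℚ.+-identityˡ _) (ℚ.*-zeroˡ (seq (fromSign (σ w e w∈e)) n))
  ... | no  _   | no  _   = pointwise⇒≃ (0ℝ +ᴿ 0ℝ *ᴿ 0ℝ) 0ℝ λ _ → refl

  incidence²-∈ : ∀ v e → v ∈ edge e → incidence v e *ᴿ incidence v e ≃ 1ℝ
  incidence²-∈ v e v∈e with v ∈? edge e
  ... | yes v∈e = fromSign² (σ v e v∈e)
  ... | no  v∉e = contradiction v∈e v∉e

  incidence²-∉ : ∀ v e → v ∉ edge e → incidence v e *ᴿ incidence v e ≃ 0ℝ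
  incidence²-∉ v e v∉e with v ∈? edge e
  ... | yes v∈e = contradiction v∈e v∉e
  ... | no  _   = pointwise⇒≃ (0ℝ *ᴿ 0ℝ) 0ℝ λ _ → refl

  adjacencyMatrix-diagonal : ∀ v → adjacencyMatrix G v v ≡ 0ℝ
  adjacencyMatrix-diagonal v with v Fin.≟ v
  ... | yes _  = refl
  ... | no v≢v = contradiction refl v≢v

  adjacencyMatrix-isSum : ∀ {v w} → v ≢ w → SumOf (adjacencyTerm G v w) (adjacencyMatrix G v w)
  adjacencyMatrix-isSum {v} {w} v≢w with v Fin.≟ w
  ... | yes v≡w = contradiction v≡w v≢w
  ... | no  _   = sumOf

  adjacencyMatrix-offDiagonal : ∀ {v w} → v ≢ w →
    adjacencyMatrix G v w ≡ sum (adjacencyTerm G v w)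
  adjacencyMatrix-offDiagonal v≢w = SumOf⇒≡ (adjacencyMatrix-isSum v≢w)

-- The intersection graph

lookup-injective : ∀ {a} {A : Set a} {xs : List A} → Unique xs →
  ∀ i j → List.lookup xs i ≡ List.lookup xs j → i ≡ j
lookup-injective (_   ∷ _)  zero    zero    _  = refl
lookup-injective (x∉  ∷ _)  zero    (suc j) eq = contradiction eq (All.lookup x∉ (∈-lookup j))
lookup-injective (x∉  ∷ _)  (suc i) zero    eq = contradiction (sym eq) (All.lookup x∉ (∈-lookup i))
lookup-injective (_   ∷ xs) (suc i) (suc j) eq = cong suc (lookup-injective xs i j eq)

module _ (G : OrientedHypergraph) where
  open OrientedHypergraph G

  Joins : Fin ∣E∣ × Fin ∣E∣ → Fin ∣E∣ → Fin ∣E∣ → Set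
  Joins p e f = e ∈ endpoints G p × f ∈ endpoints G p

  Joins⇒≡ : ∀ {e f g h} → e ≢ f → Joins (g , h) e f →
    (g , h) ≡ (e , f) ⊎ (g , h) ≡ (f , e)
  Joins⇒≡ {g = g} {h} e≢f (e∈ , f∈) with x∈p∪q⁻ ⁅ g ⁆ ⁅ h ⁆ e∈ | x∈p∪q⁻ ⁅ g ⁆ ⁅ h ⁆ f∈
  ... | inj₁ e∈g | inj₁ f∈g =
    contradiction (trans (x∈⁅y⁆⇒x≡y g e∈g) (sym (x∈⁅y⁆⇒x≡y g f∈g))) e≢f
  ... | inj₁ e∈g | inj₂ f∈h =
    inj₁ (sym (cong₂ _,_ (x∈⁅y⁆⇒x≡y g e∈g) (x∈⁅y⁆⇒x≡y h f∈h)))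
  ... | inj₂ e∈h | inj₁ f∈g =
    inj₂ (sym (cong₂ _,_ (x∈⁅y⁆⇒x≡y g f∈g) (x∈⁅y⁆⇒x≡y h e∈h)))
  ... | inj₂ e∈h | inj₂ f∈h =
    contradiction (trans (x∈⁅y⁆⇒x≡y h e∈h) (sym (x∈⁅y⁆⇒x≡y h f∈h))) e≢f

  -- Both pairs are (e , f) or (f , e), and their increasing order rules out that they are opposite.
  Joins-unique : ∀ {e f g h g′ h′} → e ≢ f → g Fin.< h → g′ Fin.< h′ →
    Joins (g , h) e f → Joins (g′ , h′) e f → (g , h) ≡ (g′ , h′)
  Joins-unique e≢f g<h g′<h′ gh g′h′ with Joins⇒≡ e≢f gh | Joins⇒≡ e≢f g′h′
  ... | inj₁ refl | inj₁ refl = refl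
  ... | inj₁ refl | inj₂ refl = contradiction g′<h′ (Fin.<-asym g<h)
  ... | inj₂ refl | inj₁ refl = contradiction g′<h′ (Fin.<-asym g<h)
  ... | inj₂ refl | inj₂ refl = refl

  intersectingPairs-unique : Unique (intersectingPairs G)
  intersectingPairs-unique =
    filter⁺ (intersectingPair? G) (cartesianProduct⁺ (allFin⁺ ∣E∣) (allFin⁺ ∣E∣))

  -- Edges of `Λ` are list positions, so uniqueness of the pair is not enough: the list must also be
  -- free of repetitions.
  joining-index-unique : ∀ {e f} → e ≢ f → ∀ i j →
    Joins (pair G i) e f → Joins (pair G j) e f → i ≡ j
  joining-index-unique e≢f i j i-joins j-joins = lookup-injective intersectingPairs-unique i j
    (Joins-unique e≢f (proj₁ (pair-intersecting G i)) (proj₁ (pair-intersecting G j))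
      i-joins j-joins)

  intersectingPair-index : ∀ p → IntersectingPair G p → ∃[ i ] p ≡ pair G i
  intersectingPair-index (g , h) meets = index gh∈ , lookup-index gh∈
    where
    gh∈ = ∈-filter⁺ (intersectingPair? G)
      (∈-cartesianProduct⁺ (∈-allFin g) (∈-allFin h)) meets

  -- Only increasing pairs are listed, so comparing `e` with `f` decides which order to look up.
  joining-index : ∀ {e f v} → e ≢ f → v ∈ edge e → v ∈ edge f →
    ∃[ i ] Joins (pair G i) e f
  joining-index {e} {f} {v} e≢f v∈e v∈f with Fin.<-cmp e f
  ... | tri≈ _ e≡f _ = contradiction e≡f e≢f
  ... | tri< e<f _ _ =
    let i , eq = intersectingPair-index (e , f) (e<f , v , x∈p∩q⁺ (v∈e , v∈f))
    in i , subst (λ p → Joins p e f) eq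
         (x∈p∪q⁺ (inj₁ (x∈⁅x⁆ e)) , x∈p∪q⁺ (inj₂ (x∈⁅x⁆ f)))
  ... | tri> _ _ f<e =
    let i , eq = intersectingPair-index (f , e) (f<e , v , x∈p∩q⁺ (v∈f , v∈e))
    in i , subst (λ p → Joins p e f) eq
         (x∈p∪q⁺ (inj₂ (x∈⁅x⁆ e)) , x∈p∪q⁺ (inj₁ (x∈⁅x⁆ f)))

  module _ (linear : Linear hypergraph) {e f : Fin ∣E∣} (e≢f : e ≢ f) where

    private
      termΛ = adjacencyTerm (Λ G linear) e f
      term* = adjacencyTerm (dual G) e f

    -- The orientation of `Λ` is read off at the vertex chosen by `commonVertex`. Linearity, through
    -- `Λ-σ`, lets `v` replace that choice, and the signs are then those of the dual.
    terms-agree : ∀ i v → Joins (pair G i) e f → v ∈ edge e → v ∈ edge f → termΛ i ≡ term* v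
    terms-agree i v (e∈ , f∈) v∈e v∈f = trans (adjacencyTerm-∈ (Λ G linear) e∈ f∈)
      (trans (cong₂ (λ s t → fromSign (Sign.opposite (s Sign.* t)))
                (Λ-σ G linear i v v∈ e e∈) (Λ-σ G linear i v v∈ f f∈))
        (sym (adjacencyTerm-∈ (dual G)
          (∈-dualEdge⁺ hypergraph v∈e) (∈-dualEdge⁺ hypergraph v∈f))))
      where
      v∈ : v ∈ intersection G (pair G i)
      v∈ with Joins⇒≡ e≢f (e∈ , f∈)
      ... | inj₁ eq = subst (λ p → v ∈ intersection G p) (sym eq) (x∈p∩q⁺ (v∈e , v∈f))
      ... | inj₂ eq = subst (λ p → v ∈ intersection G p) (sym eq) (x∈p∩q⁺ (v∈f , v∈e))

    term*-vanishes : ∀ v → ¬ (v ∈ edge e × v ∈ edge f) → term* v ≡ 0ℝ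
    term*-vanishes v v∉ = adjacencyTerm-∉ (dual G)
      λ (e∈ , f∈) → v∉ (∈-dualEdge⁻ hypergraph e∈ , ∈-dualEdge⁻ hypergraph f∈)

    -- The sums range over different index sets, pairs of edges and vertices, but each has at most
    -- one nonzero term: at the single edge joining `e` and `f`, and at their single common vertex.
    -- These terms agree.
    Λ≃dual : sum termΛ ≃ sum term*
    -- The decision is passed as an argument rather than abstracted by `with`, which keeps the sums
    -- in the goal from being normalised.
    Λ≃dual = byCommonVertex (nonempty? (edge e ∩ edge f))
      where
      termΛ-unique : ∀ i → Joins (pair G i) e f → ∀ j → j ≢ i → termΛ j ≡ 0ℝ
      termΛ-unique i i-joins j j≢i = adjacencyTerm-∉ (Λ G linear) λ j-joins →
        j≢i (joining-index-unique e≢f j i j-joins i-joins)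

      term*-unique : ∀ v → v ∈ edge e ∩ edge f → ∀ w → w ≢ v → term* w ≡ 0ℝ
      term*-unique v v∈ w w≢v = term*-vanishes w λ w∈ →
        w≢v (∣p∣≤1⇒unique G (edge e ∩ edge f) (linear e f e≢f) (x∈p∩q⁺ w∈) v∈)

      byCommonVertex : Dec (Nonempty (edge e ∩ edge f)) → sum termΛ ≃ sum term*
      byCommonVertex (yes (v , v∈)) =
        let v∈e , v∈f   = x∈p∩q⁻ (edge e) (edge f) v∈
            i , i-joins = joining-index e≢f v∈e v∈f
            Λ≃term      = sum-single termΛ i λ j j≢i →
              ≃-reflexive (termΛ j) 0ℝ (termΛ-unique i i-joins j j≢i)
            dual≃term   = sum-single term* v λ w w≢v →
              ≃-reflexive (term* w) 0ℝ (term*-unique v v∈ w w≢v)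
        in ≃-trans (sum termΛ) (termΛ i) (sum term*) Λ≃term
             (≃-trans (termΛ i) (term* v) (sum term*)
               (≃-reflexive (termΛ i) (term* v) (terms-agree i v i-joins v∈e v∈f))
               (≃-sym (sum term*) (term* v) dual≃term))
      byCommonVertex (no ∄v) =
        let Λ≃0    = sum-zero termΛ λ i → ≃-reflexive (termΛ i) 0ℝ (termΛ-empty i)
            dual≃0 = sum-zero term* λ v → ≃-reflexive (term* v) 0ℝ
              (term*-vanishes v λ v∈ → ∄v (v , x∈p∩q⁺ v∈))
        in ≃-trans (sum termΛ) 0ℝ (sum term*) Λ≃0 (≃-sym (sum term*) 0ℝ dual≃0)
        where
        termΛ-empty : ∀ i → termΛ i ≡ 0ℝ
        -- Every listed pair intersects, so an edge of `Λ` joining `e` and `f` would supply a common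
        -- vertex.
        termΛ-empty i = adjacencyTerm-∉ (Λ G linear) λ (e∈ , f∈) →
          ∄v (commonVertex G i , x∈p∩q⁺
            ( ∈-endpoint G (pair G i) (commonVertex-∈ G i) e∈
            , ∈-endpoint G (pair G i) (commonVertex-∈ G i) f∈))

  -- The dual incidence matrix and the bound k

  incidence* : Fin ∣E∣ → Fin ∣V∣ → ℝ
  incidence* = incidence (dual G)

  -- Row `e` has entries ±1 on the vertices of `e` and 0 elsewhere, so its squares form the
  -- indicator of `edge e`.
  dual-norm : ∀ e → sum (λ v → incidence* e v *ᴿ incidence* e v) ≃ fromℕ ∣ edge e ∣
  dual-norm e = sum-indicator (edge e) (λ v → incidence* e v *ᴿ incidence* e v)
    (λ v v∈e → incidence²-∈ (dual G) e v (∈-dualEdge⁺ hypergraph v∈e))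
    (λ v v∉e → incidence²-∉ (dual G) e v (v∉e ∘ ∈-dualEdge⁻ hypergraph))

  dual-cancel : ∀ e f →
    sum (adjacencyTerm (dual G) e f) +ᴿ sum (λ v → incidence* e v *ᴿ incidence* f v) ≃ 0ℝ
  dual-cancel e f = sum-cancel (adjacencyTerm (dual G) e f)
    (λ v → incidence* e v *ᴿ incidence* f v) (adjacencyTerm-cancel (dual G) e f)

  -- Asking for the dual entries only up to `≃` covers both matrices of the theorem: the dual
  -- itself, and that of `Λ`, whose entries are different sums with the same value.
  bound-of-dual-entries : ∀ k → Uniform hypergraph k → (A : Matrix ∣E∣) →
    (∀ e → A e e ≡ 0ℝ) → (∀ e f → e ≢ f → A e f ≃ sum (adjacencyTerm (dual G) e f)) →
    ∀ μ → IsEigenvalue A μ → μ ≤ᴿ fromℕ k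
  bound-of-dual-entries k uniform A A-diagonal A-offDiagonal μ eigenvalue =
    eigenvalue-bound A incidence* (+ k ℚ./ 1) diagonal offDiagonal μ eigenvalue
    where
    inner : Fin ∣E∣ → Fin ∣E∣ → ℝ
    inner e f = sum λ v → incidence* e v *ᴿ incidence* f v

    -- The size is generalised to a variable `d` so that the equation from uniformity can be matched
    -- with `refl`.
    norm≃ : ∀ e d → ∣ edge e ∣ ≡ d → inner e e ≃ fromℕ d
    norm≃ e d refl = dual-norm e

    diagonal : ∀ e → A e e +ᴿ inner e e ≃ fromℕ k
    diagonal e = ≃-trans (A e e +ᴿ inner e e) (0ℝ +ᴿ inner e e) (fromℕ k)
      (+ᴿ-cong {A e e} {0ℝ} {inner e e} {inner e e}
        (≃-reflexive (A e e) 0ℝ (A-diagonal e)) (≃-reflexive (inner e e) (inner e e) refl))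
      (≃-trans (0ℝ +ᴿ inner e e) (inner e e) (fromℕ k)
        (pointwise⇒≃ (0ℝ +ᴿ inner e e) (inner e e) λ n → ℚ.+-identityˡ (seq (inner e e) n))
        (norm≃ e k (uniform e)))

    offDiagonal : ∀ e f → e ≢ f → A e f +ᴿ inner e f ≃ 0ℝ
    offDiagonal e f e≢f =
      ≃-trans (A e f +ᴿ inner e f) (sum (adjacencyTerm (dual G) e f) +ᴿ inner e f) 0ℝ
        (+ᴿ-cong {A e f} {sum (adjacencyTerm (dual G) e f)} {inner e f} {inner e f}
          (A-offDiagonal e f e≢f) (≃-reflexive (inner e f) (inner e f) refl))
        (dual-cancel e f)

theorem4p4 : (k : ℕ) (G : OrientedHypergraph) →
    let open OrientedHypergraph G in
    Uniform hypergraph k → (linear : Linear hypergraph) → (μ : ℝ) →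
    IsEigenvalue (adjacencyMatrix (Λ G linear)) μ ⊎ IsEigenvalue (adjacencyMatrix (dual G)) μ →
    μ ≤ᴿ fromℕ k
theorem4p4 k G uniform linear μ (inj₁ eigenvalue) =
  bound-of-dual-entries G k uniform (adjacencyMatrix (Λ G linear))
    (adjacencyMatrix-diagonal (Λ G linear))
    (λ e f e≢f → ≃-trans (adjacencyMatrix (Λ G linear) e f)
      (sum (adjacencyTerm (Λ G linear) e f)) (sum (adjacencyTerm (dual G) e f))
      (≃-reflexive (adjacencyMatrix (Λ G linear) e f) (sum (adjacencyTerm (Λ G linear) e f))
        (adjacencyMatrix-offDiagonal (Λ G linear) e≢f))
      (Λ≃dual G linear e≢f))
    μ eigenvalue
theorem4p4 k G uniform linear μ (inj₂ eigenvalue) =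
  bound-of-dual-entries G k uniform (adjacencyMatrix (dual G))
    (adjacencyMatrix-diagonal (dual G))
    (λ e f e≢f → ≃-reflexive (adjacencyMatrix (dual G) e f) (sum (adjacencyTerm (dual G) e f))
      (adjacencyMatrix-offDiagonal (dual G) e≢f))
    μ eigenvalue
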